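{- Let $3\le s\le t$ be fixed integers with $s$ odd and $t$ even. Then, for all sufficiently large $n$ (depending on $s$ and $t$), $$r_{\mathrm{odd}}(n,K_{s,t})> n^{1/\left(\frac s2+\frac 1{2\lfloor t/8\rfloor}\right)}.$$
   Context: All graphs are finite and simple. $K_n$ is the complete graph on $n$ vertices and $K_{s,t}$ is the complete bipartite graph with parts of sizes $s$ and $t$. An $r$-coloring of a graph $G$ is a map $\chi:E(G)\to[r]=\{1,\dots,r\}$ (an edge-coloring, not necessarily proper or surjective). For a graph $H$, the odd-Ramsey number $r_{\mathrm{odd}}(n,H)$ is the minimum positive integer $r$ for which there is an $r$-coloring of $K_n$ such that in every (not necessarily induced) copy of $H$ in $K_n$ some color occurs on an odd number of edges of that copy. Convention: when $t<8$, so that $\lfloor t/8\rfloor=0$, the term $\frac{1}{2\lfloor t/8\rfloor}$ is read as $+\infty$ and the exponent as $0$, so the bound reads $r_{\mathrm{odd}}(n,K_{s,t})>1$. -}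

module Defs where

open import Data.Nat.Base as ℕ using (ℕ; zero; suc; _+_; _*_; _^_; _≤_; _<_; _%_)
import Data.Nat.Properties as ℕ
open import Data.Integer.Base as ℤ using (+_)
import Data.Rational.Unnormalised.Base as ℚᵘ
open ℚᵘ using (ℚᵘ; 0ℚᵘ; 1/_; ↥_; ↧ₙ_)
import Data.Rational.Unnormalised.Properties as ℚᵘ
open import Data.Fin.Base as Fin using (Fin; toℕ)
import Data.Fin.Properties as Fin
open import Data.List.Base using (List; length; filter; mapMaybe; allFin; cartesianProduct)
import Data.Maybe.Base as Maybe
open import Data.Product.Base using (_×_; _,_; ∃-syntax; Σ-syntax)
open import Data.Sum.Base using (_⊎_; inj₁; inj₂; swap)
open import Function.Definitions using (Injective)
open import Level using (0ℓ)
open import Relation.Binary.Core using (Rel)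
open import Relation.Binary.Definitions using (Decidable; Symmetric; Irreflexive)
open import Relation.Binary.PropositionalEquality using (_≡_; _≢_; refl; ≢-sym)
open import Relation.Nullary.Decidable using (dec⇒maybe; ¬?; _×-dec_; _⊎-dec_)

Even Odd : ℕ → Set
Even n = n % 2 ≡ 0
Odd  n = n % 2 ≡ 1

record Graph : Set₁ where
  field
    order  : ℕ
  Vertex : Set
  Vertex = Fin order
  field
    Adj    : Rel Vertex 0ℓ
    adj?   : Decidable Adj
    sym    : Symmetric Adj
    irrefl : Irreflexive _≡_ Adj

  -- Ordering the endpoints makes each undirected edge occur exactly once.
  Edge : Set
  Edge = Σ[ (u , v) ∈ Vertex × Vertex ] (u Fin.< v × Adj u v)

  edges : List Edge
  edges = mapMaybe
    (λ (u , v) → Maybe.map ((u , v) ,_) (dec⇒maybe (u Fin.<? v ×-dec adj? u v)))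
    (cartesianProduct (allFin order) (allFin order))

open Graph using (order; Vertex; Adj; Edge; edges)

K : ℕ → Graph
K n = record
  { order  = n
  ; Adj    = _≢_
  ; adj?   = λ u v → ¬? (u Fin.≟ v)
  ; sym    = ≢-sym
  ; irrefl = λ u≡v u≢v → u≢v u≡v
  }

-- The parts are the first s and the last t of the s + t vertices.
K[_,_] : ℕ → ℕ → Graph
K[ s , t ] = record
  { order  = s + t
  ; Adj    = λ u v → Across u v ⊎ Across v u
  ; adj?   = λ u v → across? u v ⊎-dec across? v u
  ; sym    = swap
  ; irrefl = λ { refl (inj₁ (u<s , s≤u)) → ℕ.<⇒≱ u<s s≤u
               ; refl (inj₂ (u<s , s≤u)) → ℕ.<⇒≱ u<s s≤u }
  }
  where
  Across : Rel (Fin (s + t)) 0ℓ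
  Across u v = toℕ u < s × s ≤ toℕ v

  across? : Decidable Across
  across? u v = (toℕ u ℕ.<? s) ×-dec (s ℕ.≤? toℕ v)

-- Applied twice, symmetric also makes the color independent of the adjacency
-- proof, so this is a map on undirected edges.
record EdgeColoring (G : Graph) (r : ℕ) : Set where
  field
    color     : ∀ {u v} → Adj G u v → Fin r
    symmetric : ∀ {u v} (p : Adj G u v) (q : Adj G v u) → color p ≡ color q

-- A copy of H in G is the image of H under an injective homomorphism;
-- non-edges of H may be sent to edges of G.
record Copy (H G : Graph) : Set where
  field
    vertex    : Vertex H → Vertex G
    injective : Injective _≡_ _≡_ vertex
    adj       : ∀ {u v} → Adj H u v → Adj G (vertex u) (vertex v)

module _ {G H : Graph} {r : ℕ} (χ : EdgeColoring G r) (φ : Copy H G) where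
  open EdgeColoring χ
  open Copy φ

  edgeColor : Edge H → Fin r
  edgeColor (_ , _ , uv) = color (adj uv)

  occurrences : Fin r → ℕ
  occurrences c = length (filter (λ e → edgeColor e Fin.≟ c) (edges H))

IsOddRamseyColoring : ∀ n (H : Graph) {r} → EdgeColoring (K n) r → Set
IsOddRamseyColoring n H {r} χ =
  (φ : Copy H (K n)) → ∃[ c ] Odd (occurrences χ φ c)

OddRamseyColorable : ℕ → Graph → ℕ → Set
OddRamseyColorable n H r =
  ∃[ χ ] IsOddRamseyColoring n H {r} χ

-- r is the odd-Ramsey number of H in K n.  This is a relation since the
-- minimum does not exist for every H (e.g. for edgeless H).
record IsOddRamseyNumber (n : ℕ) (H : Graph) (r : ℕ) : Set where
  field
    positive  : 1 ≤ r
    colorable : OddRamseyColorable n H r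
    minimal   : ∀ r′ → 1 ≤ r′ → OddRamseyColorable n H r′ → r ≤ r′

-- 1 / (s/2 + 1/(2k)), read as 0 when k = 0.
exponent : (s k : ℕ) → ℚᵘ
exponent s zero        = 0ℚᵘ
exponent s k@(suc _)   = (1/ d) {{ℚᵘ.pos⇒nonZero d {{d>0}}}}
  where
  s/2 1/2k d : ℚᵘ
  s/2  = + s ℚᵘ./ 2
  1/2k = + 1 ℚᵘ./ (2 * k)
  d    = s/2 ℚᵘ.+ 1/2k

  d>0 : ℚᵘ.Positive d
  d>0 = ℚᵘ.positive (ℚᵘ.+-mono-≤-< (ℚᵘ.nonNegative⁻¹ s/2) (ℚᵘ.positive⁻¹ 1/2k))

-- For α = p / q ≥ 0, the inequality r > n ^ α between reals, i.e. r ^ q > n ^ p.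
infix 4 _>_^ℚ_
_>_^ℚ_ : ℕ → ℕ → ℚᵘ → Set
r > n ^ℚ α = n ^ ℤ.∣ ↥ α ∣ < r ^ ↧ₙ α

{-# OPTIONS --safe #-}
-- Color K n with r colors and split its vertices into halves V and X of size
-- m ≈ n / 2.  For x ≠ y in X let f(x, y) be the number of a ∈ V with
-- χ(ax) = χ(ay).  By Cauchy–Schwarz the average of f is of order m / r, so by
-- convexity some s-subset A of V has at least of order m² / r ^ s pairs x ≠ y
-- with χ(ax) = χ(ay) for all a ∈ A.  If this exceeds a constant depending on t,
-- then t / 2 of these pairs are disjoint, and together with A they span a copy
-- of K[ s , t ] in which every color occurs an even number of times.  Hence
-- odd-Ramsey colorings need r ^ s > c n², and 2 / s is larger than the exponent
-- 2k / (s k + 1) with k = t / 8, which absorbs the constant.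
module Submission where

open import Defs
open import Data.Nat.Base using (ℕ; zero; suc; _+_; _*_; _∸_; _^_; _≤_; _<_; _/_; _%_; z≤n; s≤s; s≤s⁻¹; >-nonZero)
open import Data.Nat.Properties
open import Data.Nat.DivMod using (/-monoˡ-≤; m/n*n≤m; m≡m%n+[m/n]*n; m%n<n)
open import Data.Nat.Divisibility using (_∣_; divides; ∣m∣n⇒∣m+n; n∣m⇒m%n≡0; m%n≡0⇒n∣m; _∣0)
open import Data.Nat.Solver using (module +-*-Solver)
open import Data.Integer.Base using (∣_∣)
open import Data.Rational.Unnormalised.Base using (↥_; ↧ₙ_)
open import Data.Fin.Base as Fin using (Fin; zero; suc; punchIn; toℕ; inject≤; splitAt; _↑ˡ_; _↑ʳ_)
import Data.Fin.Properties as Fin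
open import Data.List.Base as List using (length; filter; mapMaybe; tabulate; cartesianProduct)
import Data.List.Properties as List
open import Data.Maybe.Base as Maybe using (Maybe; just; nothing; maybe′)
open import Data.Product.Base using (_×_; _,_; ∃-syntax; proj₁; proj₂)
open import Data.Sum.Base using (_⊎_; inj₁; inj₂; [_,_]′)
open import Data.Unit.Base using (⊤; tt)
open import Data.Bool.Base using (if_then_else_)
open import Data.Vec.Functional using (Vector; _∷_; foldr)
open import Function.Base using (_∘_; id)
open import Function.Definitions using (Injective)
open import Level using (0ℓ)
open import Relation.Binary.Core using (Rel)
open import Relation.Binary.Definitions using (Decidable; Symmetric; Transitive)
open import Relation.Binary.PropositionalEquality using (_≡_; _≢_; refl; sym; trans; cong; cong₂; subst; ≢-sym; module ≡-Reasoning)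
open import Relation.Nullary using (Dec; does; yes; no; ¬_; contradiction)
open import Relation.Nullary.Decidable using (¬?; _×-dec_; dec⇒maybe; decidable-stable)
open import Relation.Unary as U using (Pred)
open import Algebra.Properties.Semiring.Sum +-*-semiring
open Graph using (order; Vertex; Adj; adj?)
open +-*-Solver using (solve; _:=_; _:+_; _:*_; con)

private variable
  m n p q r : ℕ
  P : Set

-- Indicators, finite sums and products, and a convexity inequality

[_] : Dec P → ℕ
[ P? ] = if does P? then 1 else 0

[]≤1 : (P? : Dec P) → [ P? ] ≤ 1
[]≤1 (yes _) = ≤-refl
[]≤1 (no _)  = z≤n

[]-true : (P? : Dec P) → P → [ P? ] ≡ 1
[]-true (yes _) _ = refl
[]-true (no ¬P) p = contradiction p ¬P

≢0⇒[] : (P? : Dec P) → [ P? ] ≢ 0 → P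
≢0⇒[] (yes p) _  = p
≢0⇒[] (no _)  ≢0 = contradiction refl ≢0

[]≤ : (P? : Dec P) → (P → 1 ≤ n) → [ P? ] ≤ n
[]≤ (yes p) P⇒ = P⇒ p
[]≤ (no _)  _  = z≤n

≤[] : (P? : Dec P) → m ≤ 1 → (m ≢ 0 → P) → m ≤ [ P? ]
≤[] {m = zero}  P? m≤1 m≢0⇒P = z≤n
≤[] {m = suc _} P? m≤1 m≢0⇒P rewrite []-true P? (m≢0⇒P λ ()) = m≤1

sum-mono : {f g : Vector ℕ n} → (∀ i → f i ≤ g i) → sum f ≤ sum g
sum-mono {zero}  f≤g = z≤n
sum-mono {suc n} f≤g = +-mono-≤ (f≤g zero) (sum-mono (f≤g ∘ suc))

sum-const : ∀ n c → ∑[ i < n ] c ≡ n * c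
sum-const zero    c = refl
sum-const (suc n) c = cong (c +_) (sum-const n c)

sum≤ : {f : Vector ℕ n} {c : ℕ} → (∀ i → f i ≤ c) → sum f ≤ n * c
sum≤ {n} {f} {c} f≤c = ≤-trans (sum-mono f≤c) (≤-reflexive (sum-const n c))

term≤sum : (f : Vector ℕ n) (i : Fin n) → f i ≤ sum f
term≤sum {suc n} f i = ≤-trans (m≤m+n (f i) _) (≤-reflexive (sym (sum-remove f)))

sum-δ : (g : Vector ℕ n) (j : Fin n) → ∑[ i < n ] ([ j Fin.≟ i ] * g i) ≡ g j
sum-δ {suc n} g zero = begin
  g zero + 0 + ∑[ i < n ] 0  ≡⟨ cong₂ _+_ (+-identityʳ (g zero)) (trans (sum-const n 0) (*-zeroʳ n)) ⟩
  g zero + 0                 ≡⟨ +-identityʳ (g zero) ⟩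
  g zero                     ∎
  where open ≡-Reasoning
sum-δ {suc n} g (suc j) = sum-δ (g ∘ suc) j

sum-[≟] : (j : Fin n) → ∑[ i < n ] [ j Fin.≟ i ] ≡ 1
sum-[≟] {n} j = trans (sum-cong-≗ (λ i → sym (*-identityʳ [ j Fin.≟ i ]))) (sum-δ (λ _ → 1) j)

∃-term≥mean : (f : Vector ℕ (suc n)) → ∃[ i ] sum f ≤ suc n * f i
∃-term≥mean {zero}  f = zero , ≤-refl
∃-term≥mean {suc n} f with i , mean≤ ← ∃-term≥mean (f ∘ suc) | ≤-total (f zero) (f (suc i))
... | inj₁ f0≤fi = suc i , +-mono-≤ f0≤fi mean≤
... | inj₂ fi≤f0 = zero , +-monoʳ-≤ (f zero) (≤-trans mean≤ (*-monoʳ-≤ (suc n) fi≤f0))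

∑₂ : (Fin p → Fin q → ℕ) → ℕ
∑₂ {p} {q} f = ∑[ x < p ] ∑[ y < q ] f x y

∑₂-mono : {f g : Fin p → Fin q → ℕ} → (∀ x y → f x y ≤ g x y) → ∑₂ f ≤ ∑₂ g
∑₂-mono f≤g = sum-mono λ x → sum-mono (f≤g x)

∑₂-const : ∀ p q c → ∑₂ {p} {q} (λ _ _ → c) ≡ p * (q * c)
∑₂-const p q c = trans (sum-cong-≗ {p} (λ _ → sum-const q c)) (sum-const p (q * c))

∑₂-distrib-+ : (f g : Fin p → Fin q → ℕ) → ∑₂ (λ x y → f x y + g x y) ≡ ∑₂ f + ∑₂ g
∑₂-distrib-+ {p} f g = trans (sum-cong-≗ {p} (λ x → ∑-distrib-+ (f x) (g x))) (∑-distrib-+ (sum ∘ f) (sum ∘ g))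

*-distribˡ-∑₂ : ∀ c (f : Fin p → Fin q → ℕ) → c * ∑₂ f ≡ ∑₂ (λ x y → c * f x y)
*-distribˡ-∑₂ {p} c f = trans (*-distribˡ-sum c (sum ∘ f)) (sum-cong-≗ {p} (λ x → *-distribˡ-sum c (f x)))

∑-∑₂-comm : (f : Fin m → Fin p → Fin q → ℕ) →
            ∑[ a < m ] ∑₂ (f a) ≡ ∑₂ (λ x y → ∑[ a < m ] f a x y)
∑-∑₂-comm {m} {p} {q} f = trans (∑-comm λ a x → sum (f a x)) (sum-cong-≗ {p} λ x → ∑-comm λ a → f a x)

∏ : Vector ℕ n → ℕ
∏ = foldr _*_ 1

∏≤1 : {f : Vector ℕ n} → (∀ i → f i ≤ 1) → ∏ f ≤ 1
∏≤1 {zero}  f≤1 = ≤-refl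
∏≤1 {suc n} f≤1 = *-mono-≤ (f≤1 zero) (∏≤1 (f≤1 ∘ suc))

∏≢0 : (f : Vector ℕ n) → ∏ f ≢ 0 → ∀ i → f i ≢ 0
∏≢0 f ∏≢ zero    f0≡0 = ∏≢ (cong (_* ∏ (f ∘ suc)) f0≡0)
∏≢0 f ∏≢ (suc i) fi≡0 = ∏≢0 (f ∘ suc) (λ ∏≡0 → ∏≢ (trans (cong (f zero *_) ∏≡0) (*-zeroʳ (f zero)))) i fi≡0

-- Weakening of the tangent-line inequality for the convex function x ↦ x ^ suc j.
^-tangent : ∀ j x μ → μ ^ j * x ≤ x ^ suc j + μ ^ suc j
^-tangent j x μ with ≤-total x μ
... | inj₁ x≤μ = ≤-trans (≤-trans (*-monoʳ-≤ (μ ^ j) x≤μ) (≤-reflexive (*-comm (μ ^ j) μ))) (m≤n+m _ _)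
... | inj₂ μ≤x = ≤-trans (≤-trans (*-monoˡ-≤ x (^-monoˡ-≤ j μ≤x)) (≤-reflexive (*-comm (x ^ j) x))) (m≤m+n _ _)

-- Choosing an injective tuple by averaging

∷-injective : {A : Set} {a : A} {f : Vector A n} →
              (∀ i → f i ≢ a) → Injective _≡_ _≡_ f → Injective _≡_ _≡_ (a ∷ f)
∷-injective a∉f f-inj {zero}  {zero}  _  = refl
∷-injective a∉f f-inj {zero}  {suc j} eq = contradiction (sym eq) (a∉f j)
∷-injective a∉f f-inj {suc i} {zero}  eq = contradiction eq (a∉f i)
∷-injective a∉f f-inj {suc i} {suc j} eq = cong suc (f-inj eq)

-- Method of conditional expectations: the a's are picked one at a time, each
-- keeping the potential ∑₂ w · (deg ∸ j) ^ j at least at its average.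
∃-injective≥mean :
  ∀ j (I : Fin p → Fin q → Fin m → ℕ) → (∀ x y a → I x y a ≤ 1) → (w : Fin p → Fin q → ℕ) → j ≤ m →
  ∃[ A ] Injective _≡_ _≡_ A ×
    ∑₂ (λ x y → w x y * (sum (I x y) ∸ j) ^ j) ≤ m ^ j * ∑₂ (λ x y → w x y * ∏ {j} (I x y ∘ A))
∃-injective≥mean zero I I≤1 w _ = (λ ()) , (λ { {()} }) , m≤m+n _ 0
∃-injective≥mean {p} {q} {suc m} (suc j) I I≤1 w (s≤s j≤m) = a ∷ A′ , a∷A′-inj , (begin
  ∑₂ (λ x y → w x y * (deg x y ∸ suc j) ^ suc j)
    ≤⟨ ∑₂-mono pointwise ⟩
  ∑₂ (λ x y → ∑[ b < suc m ] Φ b x y)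
    ≡⟨ ∑-∑₂-comm Φ ⟨
  ∑[ b < suc m ] ∑₂ (Φ b)
    ≤⟨ mean≤ ⟩
  suc m * ∑₂ (Φ a)
    ≤⟨ *-monoʳ-≤ (suc m) (∑₂-mono λ x y → *-monoʳ-≤ (w x y * I x y a) (^-monoˡ-≤ j (deg′≥ x y))) ⟩
  suc m * ∑₂ (λ x y → w x y * I x y a * (sum (I′ x y) ∸ j) ^ j)
    ≤⟨ *-monoʳ-≤ (suc m) IH ⟩
  suc m * (m ^ j * ∑₂ (λ x y → w x y * I x y a * ∏ (I′ x y ∘ A)))
    ≤⟨ *-monoʳ-≤ (suc m) (*-mono-≤ (^-monoˡ-≤ j (n≤1+n m)) (∑₂-mono λ x y → ≤-reflexive (*-assoc (w x y) _ _))) ⟩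
  suc m * (suc m ^ j * ∑₂ (λ x y → w x y * ∏ (I x y ∘ (a ∷ A′))))
    ≡⟨ *-assoc (suc m) (suc m ^ j) _ ⟨
  suc m ^ suc j * ∑₂ (λ x y → w x y * ∏ (I x y ∘ (a ∷ A′))) ∎)
  where
  open ≤-Reasoning
  deg : Fin p → Fin q → ℕ
  deg x y = sum (I x y)
  Φ : Fin (suc m) → Fin p → Fin q → ℕ
  Φ b x y = w x y * I x y b * (deg x y ∸ suc j) ^ j
  chosen : ∃[ a ] ∑[ b < suc m ] ∑₂ (Φ b) ≤ suc m * ∑₂ (Φ a)
  chosen = ∃-term≥mean λ b → ∑₂ (Φ b)
  a = proj₁ chosen
  mean≤ = proj₂ chosen
  -- `punchIn a` enumerates the elements other than `a`, so later picks cannot repeat it.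
  I′ : Fin p → Fin q → Fin m → ℕ
  I′ x y b = I x y (punchIn a b)
  -- The weight absorbs the indicator at `a`, so that the recursive product over `A` completes to
  -- the product over `a ∷ A′`.
  rec = ∃-injective≥mean j I′ (λ x y b → I≤1 x y (punchIn a b)) (λ x y → w x y * I x y a) j≤m
  A = proj₁ rec
  A-inj : Injective _≡_ _≡_ A
  A-inj = proj₁ (proj₂ rec)
  IH = proj₂ (proj₂ rec)
  A′ : Vector (Fin (suc m)) j
  A′ = punchIn a ∘ A
  a∷A′-inj : Injective _≡_ _≡_ (a ∷ A′)
  a∷A′-inj = ∷-injective (λ i → Fin.punchInᵢ≢i a (A i)) (A-inj ∘ Fin.punchIn-injective a _ _)
  -- One factor of the power is relaxed to `deg x y`, which is then spread over the candidates `b`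
  -- for the next pick.
  pointwise : ∀ x y → w x y * (deg x y ∸ suc j) ^ suc j ≤ ∑[ b < suc m ] Φ b x y
  pointwise x y = begin
    w x y * ((deg x y ∸ suc j) * X)  ≤⟨ *-monoʳ-≤ (w x y) (*-monoˡ-≤ X (m∸n≤m (deg x y) (suc j))) ⟩
    w x y * (deg x y * X)            ≡⟨ *-assoc (w x y) (deg x y) X ⟨
    w x y * deg x y * X              ≡⟨ cong (_* X) (*-distribˡ-sum (w x y) (I x y)) ⟩
    sum (λ b → w x y * I x y b) * X  ≡⟨ *-distribʳ-sum X (λ b → w x y * I x y b) ⟩
    ∑[ b < suc m ] Φ b x y           ∎
    where X = (deg x y ∸ suc j) ^ j
  -- Removing `a` lowers a degree by at most one, and the truncation drops by one at the same time.
  deg′≥ : ∀ x y → deg x y ∸ suc j ≤ sum (I′ x y) ∸ j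
  deg′≥ x y = begin
    deg x y ∸ suc j               ≡⟨ cong (_∸ suc j) (sum-remove {i = a} (I x y)) ⟩
    I x y a + sum (I′ x y) ∸ suc j  ≤⟨ ∸-monoˡ-≤ (suc j) (+-monoˡ-≤ (sum (I′ x y)) (I≤1 x y a)) ⟩
    sum (I′ x y) ∸ j              ∎

-- Monochromatic pairs in a single vertex coloring

^-distribʳ-* : ∀ j m n → (m * n) ^ j ≡ m ^ j * n ^ j
^-distribʳ-* zero    m n = refl
^-distribʳ-* (suc j) m n = trans (cong (m * n *_) (^-distribʳ-* j m n))
  (solve 4 (λ m n u v → m :* n :* (u :* v) := m :* u :* (n :* v)) refl m n (m ^ j) (n ^ j))

-- Cauchy-Schwarz for the sizes d(e) of the color classes: they add up to m, and their squares add
-- up to the number of monochromatic ordered pairs. The factor 4 is the loss from using `^-tangent`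
-- in its place.
square≤agreements : (c : Fin m → Fin r) → m * m ≤ 4 * r * ∑₂ (λ x y → [ c x Fin.≟ c y ])
square≤agreements {zero}  {_}     c = z≤n
square≤agreements {suc m} {zero}  c with () ← c zero
square≤agreements {m@(suc _)} {r@(suc _)} c = *-cancelˡ-≤ r (+-cancelʳ-≤ (r * (m * m)) _ _ (begin
  r * (m * m) + r * (m * m)
    ≡⟨ solve 2 (λ r m → r :* (m :* m) :+ r :* (m :* m) := m :* (con 2 :* r :* m)) refl r m ⟩
  m * (2 * r * m)
    ≡⟨ cong (λ z → m * (2 * r * z)) ∑d≡m ⟨
  m * (2 * r * ∑[ e < r ] d e)
    ≡⟨ cong (m *_) (*-distribˡ-sum (2 * r) d) ⟩
  m * ∑[ e < r ] (2 * r * d e)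
    ≡⟨ *-distribˡ-sum m (λ e → 2 * r * d e) ⟩
  ∑[ e < r ] (m * (2 * r * d e))
    -- The instance x = 2 r d(e), μ = m. Summed over e, the left side is 2 r m², and the error r m²
    -- cancels half of it.
    ≤⟨ sum-mono (λ e → ≤-trans (≤-reflexive (cong (_* (2 * r * d e)) (sym (*-identityʳ m)))) (^-tangent 1 (2 * r * d e) m)) ⟩
  ∑[ e < r ] ((2 * r * d e) ^ 2 + m ^ 2)
    ≡⟨ sum-cong-≗ (λ e → solve 3 (λ r d m → (con 2 :* r :* d) :* ((con 2 :* r :* d) :* con 1) :+ m :* (m :* con 1)
                                         := con 4 :* (r :* r) :* (d :* d) :+ m :* m) refl r (d e) m) ⟩
  ∑[ e < r ] (4 * (r * r) * (d e * d e) + m * m)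
    ≡⟨ ∑-distrib-+ (λ e → 4 * (r * r) * (d e * d e)) (λ _ → m * m) ⟩
  ∑[ e < r ] (4 * (r * r) * (d e * d e)) + ∑[ e < r ] (m * m)
    ≡⟨ cong₂ _+_ (sym (*-distribˡ-sum (4 * (r * r)) (λ e → d e * d e))) (sum-const r (m * m)) ⟩
  4 * (r * r) * ∑[ e < r ] (d e * d e) + r * (m * m)
    ≡⟨ cong (_+ r * (m * m)) (cong (4 * (r * r) *_) ∑d²≡) ⟩
  4 * (r * r) * S + r * (m * m)
    ≡⟨ cong (_+ r * (m * m)) (solve 2 (λ r S → con 4 :* (r :* r) :* S := r :* (con 4 :* r :* S)) refl r S) ⟩
  r * (4 * r * S) + r * (m * m) ∎))
  where
  open ≤-Reasoning
  d : Fin r → ℕ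
  d e = ∑[ x < m ] [ c x Fin.≟ e ]
  S = ∑₂ (λ x y → [ c x Fin.≟ c y ])
  ∑d≡m : ∑[ e < r ] d e ≡ m
  ∑d≡m = trans (∑-comm (λ e x → [ c x Fin.≟ e ]))
    (trans (sum-cong-≗ (λ x → sum-[≟] (c x))) (trans (sum-const m 1) (*-identityʳ m)))
  ∑d²≡ : ∑[ e < r ] (d e * d e) ≡ S
  ∑d²≡ = begin-equality
    ∑[ e < r ] (d e * d e)
      ≡⟨ sum-cong-≗ (λ e → *-distribʳ-sum (d e) (λ x → [ c x Fin.≟ e ])) ⟩
    ∑[ e < r ] ∑[ x < m ] ([ c x Fin.≟ e ] * d e)
      ≡⟨ ∑-comm (λ e x → [ c x Fin.≟ e ] * d e) ⟩
    ∑[ x < m ] ∑[ e < r ] ([ c x Fin.≟ e ] * d e)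
      ≡⟨ sum-cong-≗ (λ x → sum-δ d (c x)) ⟩
    ∑[ x < m ] d (c x)
      ≡⟨ ∑-comm (λ x y → [ c y Fin.≟ c x ]) ⟩
    S ∎

-- Disjoint pairs inside the classes of an equivalence relation

Paired : {A : Set} → Rel A 0ℓ → ∀ h → Vector A (h * 2) → Set
Paired R zero    b = ⊤
-- Since `suc h * 2` reduces to two more than `h * 2`, the two leading entries are available as the
-- first pair.
Paired R (suc h) b = R (b zero) (b (suc zero)) × Paired R h (λ i → b (suc (suc i)))

-- The bound 2k(k + 1) of `maximal⇒few-pairs` for k = 2h.
maxPairs : ℕ → ℕ
maxPairs h = 2 * (h * 2 * suc (h * 2))

maxPairs-suc : ∀ h → maxPairs h ≤ maxPairs (suc h)
maxPairs-suc h = *-monoʳ-≤ 2 (*-mono-≤ 2h≤ (s≤s 2h≤))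
  where
  2h≤ : h * 2 ≤ suc h * 2
  2h≤ = m≤n+m (h * 2) 2

distinctPairs : {R : Rel (Fin m) 0ℓ} → Decidable R → ℕ
distinctPairs R? = ∑₂ (λ x y → [ ¬? (x Fin.≟ y) ×-dec R? x y ])

module _ {m : ℕ} {_~_ : Rel (Fin m) 0ℓ} (_~?_ : Decidable _~_)
         (~-sym : Symmetric _~_) (~-trans : Transitive _~_) where

  private
    distinctPair? : ∀ x y → Dec (x ≢ y × x ~ y)
    distinctPair? x y = ¬? (x Fin.≟ y) ×-dec (x ~? y)

    Disjoint : Vector (Fin m) n → Fin m → Fin m → Set
    Disjoint b x y = (x ≢ y × x ~ y) × (∀ i → b i ≢ x) × (∀ i → b i ≢ y)

  -- A class meets the complement of b at most once, so it has at most suc k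
  -- elements, and every pair has an end in b.
  maximal⇒few-pairs : ∀ {k} (b : Vector (Fin m) k) → (∀ x y → ¬ Disjoint b x y) →
                      distinctPairs _~?_ ≤ 2 * (k * suc k)
  maximal⇒few-pairs {k} b maximal = begin
    distinctPairs _~?_
      ≤⟨ ∑₂-mono pointwise ⟩
    ∑₂ (λ x y → e x y + e y x)
      ≡⟨ ∑₂-distrib-+ e (λ x y → e y x) ⟩
    ∑₂ e + ∑₂ (λ x y → e y x)
      ≡⟨ cong (∑₂ e +_) (∑-comm (λ x y → e y x)) ⟩
    ∑₂ e + ∑₂ e
      ≤⟨ +-mono-≤ ∑e≤ ∑e≤ ⟩
    k * suc k + k * suc k
      ≡⟨ cong (k * suc k +_) (+-identityʳ _) ⟨
    2 * (k * suc k) ∎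
    where
    open ≤-Reasoning
    inb : Fin m → ℕ
    inb x = ∑[ i < k ] [ b i Fin.≟ x ]
    -- Charges a related pair to its end `x`, provided that this end occurs in `b`.
    e : Fin m → Fin m → ℕ
    e x y = inb x * [ x ~? y ]
    ∈b : ∀ i → 1 ≤ inb (b i)
    ∈b i = ≤-trans (≤-reflexive (sym ([]-true (b i Fin.≟ b i) refl))) (term≤sum (λ j → [ b j Fin.≟ b i ]) i)
    ∑inb : sum inb ≡ k
    ∑inb = trans (∑-comm (λ x i → [ b i Fin.≟ x ]))
      (trans (sum-cong-≗ (λ i → sum-[≟] (b i))) (trans (sum-const k 1) (*-identityʳ k)))
    b∌? : ∀ x → Dec (∃[ i ] b i ≡ x)
    b∌? x = Fin.any? (λ i → b i Fin.≟ x)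
    degree≤ : ∀ x → ∑[ y < m ] [ x ~? y ] ≤ suc k
    degree≤ x with Fin.any? (λ y → (x ~? y) ×-dec ¬? (b∌? y))
    ... | no none = begin
      ∑[ y < m ] [ x ~? y ]  ≤⟨ sum-mono inside ⟩
      sum inb                ≡⟨ ∑inb ⟩
      k                      ≤⟨ n≤1+n k ⟩
      suc k                  ∎
      where
      inside : ∀ y → [ x ~? y ] ≤ inb y
      inside y with x ~? y | b∌? y
      ... | no  _   | _              = z≤n
      ... | yes _   | yes (i , refl) = ∈b i
      ... | yes x~y | no y∉b         = contradiction (y , x~y , y∉b) none
    ... | yes (y₀ , x~y₀ , y₀∉b) = begin
      ∑[ y < m ] [ x ~? y ]                       ≤⟨ sum-mono inside ⟩
      ∑[ y < m ] ([ y₀ Fin.≟ y ] + inb y)         ≡⟨ ∑-distrib-+ (λ y → [ y₀ Fin.≟ y ]) inb ⟩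
      ∑[ y < m ] [ y₀ Fin.≟ y ] + sum inb         ≡⟨ cong₂ _+_ (sum-[≟] y₀) ∑inb ⟩
      suc k                                       ∎
      where
      inside : ∀ y → [ x ~? y ] ≤ [ y₀ Fin.≟ y ] + inb y
      inside y with x ~? y | y₀ Fin.≟ y | b∌? y
      ... | no  _   | _      | _              = z≤n
      ... | yes _   | yes _  | _              = s≤s z≤n
      ... | yes _   | no _   | yes (i , refl) = ∈b i
      ... | yes x~y | no y₀≢y | no y∉b        = contradiction
        ((y₀≢y , ~-trans (~-sym x~y₀) x~y) , (λ i bi≡ → y₀∉b (i , bi≡)) , (λ i bi≡ → y∉b (i , bi≡)))
        (maximal y₀ y)
    ∑e≤ : ∑₂ e ≤ k * suc k
    ∑e≤ = begin
      ∑₂ e                                             ≡⟨ sum-cong-≗ (λ x → sym (*-distribˡ-sum (inb x) (λ y → [ x ~? y ]))) ⟩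
      ∑[ x < m ] (inb x * ∑[ y < m ] [ x ~? y ])       ≤⟨ sum-mono (λ x → *-monoʳ-≤ (inb x) (degree≤ x)) ⟩
      ∑[ x < m ] (inb x * suc k)                       ≡⟨ *-distribʳ-sum (suc k) inb ⟨
      sum inb * suc k                                  ≡⟨ cong (_* suc k) ∑inb ⟩
      k * suc k                                        ∎
    pointwise : ∀ x y → [ distinctPair? x y ] ≤ e x y + e y x
    pointwise x y = []≤ (distinctPair? x y) covered
      where
      covered : x ≢ y × x ~ y → 1 ≤ e x y + e y x
      covered (x≢y , x~y) rewrite []-true (x ~? y) x~y | []-true (y ~? x) (~-sym x~y)
                                | *-identityʳ (inb x) | *-identityʳ (inb y) with b∌? x | b∌? y
      ... | yes (i , refl) | _              = ≤-trans (∈b i) (m≤m+n _ _)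
      ... | no _           | yes (i , refl) = ≤-trans (∈b i) (m≤n+m _ _)
      ... | no x∉b         | no y∉b         = contradiction
        ((x≢y , x~y) , (λ i bi≡ → x∉b (i , bi≡)) , (λ i bi≡ → y∉b (i , bi≡))) (maximal x y)

  -- Greedy choice: either a further pair avoids the pairs chosen so far, or these are maximal and
  -- `maximal⇒few-pairs` contradicts the hypothesis.
  many-pairs⇒paired : ∀ h → maxPairs h < distinctPairs _~?_ →
                      ∃[ b ] Injective _≡_ _≡_ b × Paired _~_ h b
  many-pairs⇒paired zero    _    = (λ ()) , (λ { {()} }) , tt
  many-pairs⇒paired (suc h) many
    with b , b-inj , b-paired ← many-pairs⇒paired h (≤-<-trans (maxPairs-suc h) many)
       | Fin.any? (λ x → Fin.any? (λ y →
           distinctPair? x y ×-dec Fin.all? (λ i → ¬? (b i Fin.≟ x)) ×-dec Fin.all? (λ i → ¬? (b i Fin.≟ y))))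
  ... | yes (x , y , (x≢y , x~y) , x∉b , y∉b) =
    x ∷ y ∷ b , ∷-injective x∉y∷b (∷-injective y∉b b-inj) , x~y , b-paired
    where
    x∉y∷b : ∀ i → (y ∷ b) i ≢ x
    x∉y∷b zero    y≡x = x≢y (sym y≡x)
    x∉y∷b (suc i)     = x∉b i
  ... | no none = contradiction
    (≤-trans (maximal⇒few-pairs b (λ x y d → none (x , y , d))) (maxPairs-suc h)) (<⇒≱ many)

-- Many pairs agreeing on a common tuple

module _ {m r : ℕ} (c : Fin m → Fin m → Fin r) where

  Agree : ∀ {s} → Vector (Fin m) s → Rel (Fin m) 0ℓ
  Agree A x y = ∀ i → c (A i) x ≡ c (A i) y

  agree? : ∀ {s} (A : Vector (Fin m) s) → Decidable (Agree A)
  agree? A x y = Fin.all? (λ i → c (A i) x Fin.≟ c (A i) y)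

  private
    I : Fin m → Fin m → Fin m → ℕ
    I x y a = [ c a x Fin.≟ c a y ]

    w : Fin m → Fin m → ℕ
    w x y = [ ¬? (x Fin.≟ y) ]

    deg : Fin m → Fin m → ℕ
    deg x y = sum (I x y)

  -- Each row `c a` is a coloring to which `square≤agreements` applies; summing over `a` and
  -- exchanging sums counts the same agreements pair by pair.
  cube≤∑deg : m * (m * m) ≤ 4 * r * ∑₂ deg
  cube≤∑deg = begin
    m * (m * m)                                     ≡⟨ sum-const m (m * m) ⟨
    ∑[ a < m ] (m * m)                              ≤⟨ sum-mono (λ a → square≤agreements (c a)) ⟩
    ∑[ a < m ] (4 * r * ∑₂ (λ x y → I x y a))       ≡⟨ *-distribˡ-sum (4 * r) (λ a → ∑₂ (λ x y → I x y a)) ⟨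
    4 * r * ∑[ a < m ] ∑₂ (λ x y → I x y a)         ≡⟨ cong (4 * r *_) (∑-∑₂-comm (λ a x y → I x y a)) ⟩
    4 * r * ∑₂ deg                                  ∎
    where open ≤-Reasoning

  -- Truncation costs at most s on each pair, and each of the m diagonal pairs, killed by `w`, costs
  -- at most m more.
  ∑deg≤ : ∀ s → ∑₂ deg ≤ ∑₂ (λ x y → w x y * (deg x y ∸ s)) + suc s * (m * m)
  ∑deg≤ s = begin
    ∑₂ deg
      ≤⟨ ∑₂-mono pointwise ⟩
    ∑₂ (λ x y → w x y * (deg x y ∸ s) + (s + [ x Fin.≟ y ] * m))
      ≡⟨ ∑₂-distrib-+ (λ x y → w x y * (deg x y ∸ s)) (λ x y → s + [ x Fin.≟ y ] * m) ⟩
    F + ∑₂ {m} (λ x y → s + [ x Fin.≟ y ] * m)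
      ≡⟨ cong (F +_) (∑₂-distrib-+ {m} (λ _ _ → s) (λ x y → [ x Fin.≟ y ] * m)) ⟩
    F + (∑₂ {m} {m} (λ _ _ → s) + ∑₂ {m} (λ x y → [ x Fin.≟ y ] * m))
      ≡⟨ cong (F +_) (cong₂ _+_ (∑₂-const m m s) (trans (sum-cong-≗ {m} (λ x → sum-δ (λ _ → m) x)) (sum-const m m))) ⟩
    F + (m * (m * s) + m * m)
      ≡⟨ cong (F +_) (solve 2 (λ m s → m :* (m :* s) :+ m :* m := (con 1 :+ s) :* (m :* m)) refl m s) ⟩
    F + suc s * (m * m) ∎
    where
    open ≤-Reasoning
    F = ∑₂ (λ x y → w x y * (deg x y ∸ s))
    pointwise : ∀ x y → deg x y ≤ w x y * (deg x y ∸ s) + (s + [ x Fin.≟ y ] * m)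
    pointwise x y with x Fin.≟ y
    ... | yes _ = begin
      deg x y      ≤⟨ sum≤ (λ a → []≤1 (c a x Fin.≟ c a y)) ⟩
      m * 1        ≡⟨ *-comm m 1 ⟩
      1 * m        ≤⟨ m≤n+m (1 * m) s ⟩
      s + 1 * m    ∎
    ... | no _ = begin
      deg x y                      ≤⟨ m≤n+m∸n (deg x y) s ⟩
      s + (deg x y ∸ s)            ≡⟨ solve 2 (λ s d → s :+ d := con 1 :* d :+ (s :+ con 0)) refl s (deg x y ∸ s) ⟩
      1 * (deg x y ∸ s) + (s + 0)  ∎

  -- After doubling, the error of `∑deg≤` is 8 r (s + 1) m², which the size hypothesis bounds by one
  -- of the two copies of m³.
  cube≤∑truncated-deg : ∀ s → 8 * r * suc s ≤ m →
    m * (m * m) ≤ 8 * r * ∑₂ (λ x y → w x y * (deg x y ∸ s))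
  cube≤∑truncated-deg s m-large = +-cancelʳ-≤ (m * (m * m)) _ _ (begin
    m * (m * m) + m * (m * m)
      ≡⟨ cong (m * (m * m) +_) (+-identityʳ _) ⟨
    2 * (m * (m * m))
      ≤⟨ *-monoʳ-≤ 2 (≤-trans cube≤∑deg (*-monoʳ-≤ (4 * r) (∑deg≤ s))) ⟩
    2 * (4 * r * (F + suc s * (m * m)))
      ≡⟨ solve 4 (λ r F s m² → con 2 :* (con 4 :* r :* (F :+ (con 1 :+ s) :* m²))
                  := con 8 :* r :* F :+ con 8 :* r :* (con 1 :+ s) :* m²) refl r F s (m * m) ⟩
    8 * r * F + 8 * r * suc s * (m * m)
      ≤⟨ +-monoʳ-≤ (8 * r * F) (*-monoˡ-≤ (m * m) m-large) ⟩
    8 * r * F + m * (m * m) ∎)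
    where
    open ≤-Reasoning
    F = ∑₂ (λ x y → w x y * (deg x y ∸ s))

  -- Convexity, through `^-tangent` at x = R g and μ = m. Since R is at least twice 8 r, the main
  -- term is two copies of the left side, and one of them pays for the error summed over all m²
  -- pairs.
  power≤∑deg-power : ∀ j {R} → 16 * r ≤ R → 8 * r * suc (suc j) ≤ m →
    m ^ suc j * (m * m) ≤ R ^ suc j * ∑₂ (λ x y → w x y * (deg x y ∸ suc j) ^ suc j)
  power≤∑deg-power j {R} 16r≤R m-large = +-cancelʳ-≤ (m ^ suc j * (m * m)) _ _ (begin
    m ^ suc j * (m * m) + m ^ suc j * (m * m)
      ≡⟨ solve 2 (λ m mʲ → m :* mʲ :* (m :* m) :+ m :* mʲ :* (m :* m) := mʲ :* (con 2 :* (m :* (m :* m)))) refl m (m ^ j) ⟩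
    m ^ j * (2 * (m * (m * m)))
      ≤⟨ *-monoʳ-≤ (m ^ j) (*-monoʳ-≤ 2 (cube≤∑truncated-deg (suc j) m-large)) ⟩
    m ^ j * (2 * (8 * r * F))
      ≤⟨ *-monoʳ-≤ (m ^ j) 2*8rF≤RF ⟩
    m ^ j * (R * F)
      ≡⟨ *-assoc (m ^ j) R F ⟨
    m ^ j * R * F
      ≡⟨ *-distribˡ-∑₂ (m ^ j * R) (λ x y → w x y * g x y) ⟩
    ∑₂ (λ x y → m ^ j * R * (w x y * g x y))
      ≤⟨ ∑₂-mono pointwise ⟩
    ∑₂ (λ x y → R ^ suc j * (w x y * g x y ^ suc j) + m ^ suc j)
      ≡⟨ ∑₂-distrib-+ {m} (λ x y → R ^ suc j * (w x y * g x y ^ suc j)) (λ _ _ → m ^ suc j) ⟩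
    ∑₂ (λ x y → R ^ suc j * (w x y * g x y ^ suc j)) + ∑₂ {m} {m} (λ _ _ → m ^ suc j)
      ≡⟨ cong₂ _+_ (sym (*-distribˡ-∑₂ (R ^ suc j) (λ x y → w x y * g x y ^ suc j)))
           (trans (∑₂-const m m (m ^ suc j)) (solve 2 (λ m z → m :* (m :* z) := z :* (m :* m)) refl m (m ^ suc j))) ⟩
    R ^ suc j * ∑₂ (λ x y → w x y * g x y ^ suc j) + m ^ suc j * (m * m) ∎)
    where
    open ≤-Reasoning
    g : Fin m → Fin m → ℕ
    g x y = deg x y ∸ suc j
    F = ∑₂ (λ x y → w x y * g x y)
    2*8rF≤RF : 2 * (8 * r * F) ≤ R * F
    2*8rF≤RF = begin
      2 * (8 * r * F)  ≡⟨ *-assoc 2 (8 * r) F ⟨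
      2 * (8 * r) * F  ≡⟨ cong (_* F) (*-assoc 2 8 r) ⟨
      16 * r * F       ≤⟨ *-monoˡ-≤ F 16r≤R ⟩
      R * F            ∎
    pointwise : ∀ x y → m ^ j * R * (w x y * g x y) ≤ R ^ suc j * (w x y * g x y ^ suc j) + m ^ suc j
    pointwise x y = begin
      m ^ j * R * (w x y * g x y)
        ≡⟨ solve 4 (λ u R w g → u :* R :* (w :* g) := w :* (u :* (R :* g))) refl (m ^ j) R (w x y) (g x y) ⟩
      w x y * (m ^ j * (R * g x y))
        ≤⟨ *-monoʳ-≤ (w x y) (^-tangent j (R * g x y) m) ⟩
      w x y * ((R * g x y) ^ suc j + m ^ suc j)
        ≡⟨ *-distribˡ-+ (w x y) _ _ ⟩
      w x y * (R * g x y) ^ suc j + w x y * m ^ suc j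
        ≤⟨ +-mono-≤ (≤-reflexive (cong (w x y *_) (^-distribʳ-* (suc j) R (g x y))))
             (≤-trans (*-monoˡ-≤ (m ^ suc j) ([]≤1 (¬? (x Fin.≟ y)))) (≤-reflexive (*-identityˡ _))) ⟩
      w x y * (R ^ suc j * g x y ^ suc j) + m ^ suc j
        ≡⟨ cong (_+ m ^ suc j) (solve 3 (λ w a b → w :* (a :* b) := a :* (w :* b)) refl (w x y) (R ^ suc j) (g x y ^ suc j)) ⟩
      R ^ suc j * (w x y * g x y ^ suc j) + m ^ suc j ∎

  -- The power m ^ (j + 1) lost by averaging over tuples cancels the one gained by convexity. A
  -- product of indicators over `A` is nonzero only when the pair agrees on all of `A`.
  ∃-many-agreements : ∀ j {R} → 16 * r ≤ R → 1 ≤ m → 1 ≤ r → 8 * r * suc (suc j) ≤ m →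
    ∃[ A ] Injective _≡_ _≡_ A × m * m ≤ R ^ suc j * distinctPairs (agree? {suc j} A)
  ∃-many-agreements j {R} 16r≤R 1≤m 1≤r m-large = A , A-inj , *-cancelˡ-≤ (m ^ suc j) {{m^n≢0 m (suc j) {{>-nonZero 1≤m}}}} (begin
    m ^ suc j * (m * m)
      ≤⟨ power≤∑deg-power j 16r≤R m-large ⟩
    R ^ suc j * ∑₂ (λ x y → w x y * (deg x y ∸ suc j) ^ suc j)
      ≤⟨ *-monoʳ-≤ (R ^ suc j) mean≤ ⟩
    R ^ suc j * (m ^ suc j * ∑₂ (λ x y → w x y * ∏ (I x y ∘ A)))
      ≤⟨ *-monoʳ-≤ (R ^ suc j) (*-monoʳ-≤ (m ^ suc j) (∑₂-mono pointwise)) ⟩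
    R ^ suc j * (m ^ suc j * distinctPairs (agree? A))
      ≡⟨ solve 3 (λ a b c → a :* (b :* c) := b :* (a :* c)) refl (R ^ suc j) (m ^ suc j) (distinctPairs (agree? A)) ⟩
    m ^ suc j * (R ^ suc j * distinctPairs (agree? A)) ∎)
    where
    open ≤-Reasoning
    j≤m : suc j ≤ m
    j≤m = begin
      suc j                      ≤⟨ n≤1+n (suc j) ⟩
      suc (suc j)                ≡⟨ *-identityˡ (suc (suc j)) ⟨
      1 * suc (suc j)            ≤⟨ *-monoˡ-≤ (suc (suc j)) (*-mono-≤ {1} {8} (s≤s z≤n) 1≤r) ⟩
      8 * r * suc (suc j)        ≤⟨ m-large ⟩
      m                          ∎
    selection = ∃-injective≥mean (suc j) I (λ x y a → []≤1 (c a x Fin.≟ c a y)) w j≤m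
    A = proj₁ selection
    A-inj : Injective _≡_ _≡_ A
    A-inj = proj₁ (proj₂ selection)
    mean≤ = proj₂ (proj₂ selection)
    pointwise : ∀ x y → w x y * ∏ (I x y ∘ A) ≤ [ ¬? (x Fin.≟ y) ×-dec agree? A x y ]
    pointwise x y = ≤[] (¬? (x Fin.≟ y) ×-dec agree? A x y)
      (*-mono-≤ ([]≤1 (¬? (x Fin.≟ y))) (∏≤1 (λ i → []≤1 (c (A i) x Fin.≟ c (A i) y))))
      (λ ≢0 → ≢0⇒[] (¬? (x Fin.≟ y)) (λ w≡0 → ≢0 (cong (_* ∏ (I x y ∘ A)) w≡0))
            , λ i → ≢0⇒[] (c (A i) x Fin.≟ c (A i) y)
                (∏≢0 (I x y ∘ A) (λ ∏≡0 → ≢0 (trans (cong (w x y *_) ∏≡0) (*-zeroʳ (w x y)))) i))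

  -- Agreement on `A` is an equivalence relation, so enough agreeing pairs contain h disjoint ones.
  ∃-even-bipartite : ∀ j h {R} → 16 * r ≤ R → 1 ≤ m → 1 ≤ r → 8 * r * suc (suc j) ≤ m → R ^ suc j * maxPairs h < m * m →
    ∃[ A ] ∃[ b ] Injective _≡_ _≡_ A × Injective _≡_ _≡_ b × Paired (Agree {suc j} A) h b
  ∃-even-bipartite j h {R} 16r≤R 1≤m 1≤r m-large m²-large = A , proj₁ pairing , A-inj , proj₂ pairing
    where
    choice = ∃-many-agreements j 16r≤R 1≤m 1≤r m-large
    A = proj₁ choice
    A-inj : Injective _≡_ _≡_ A
    A-inj = proj₁ (proj₂ choice)
    many : maxPairs h < distinctPairs (agree? A)
    many = *-cancelˡ-< (R ^ suc j) (maxPairs h) (distinctPairs (agree? A)) (<-≤-trans m²-large (proj₂ (proj₂ choice)))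
    pairing = many-pairs⇒paired (agree? A) (λ f i → sym (f i)) (λ f g i → trans (f i) (g i)) h many

-- Parity of sums

sum-++ : ∀ s {t} (f : Vector ℕ (s + t)) → sum f ≡ ∑[ i < s ] f (i ↑ˡ t) + ∑[ j < t ] f (s ↑ʳ j)
sum-++ zero    f = refl
sum-++ (suc s) f = trans (cong (f zero +_) (sum-++ s (f ∘ suc))) (sym (+-assoc (f zero) _ _))

∣-sum : ∀ {d} {f : Vector ℕ n} → (∀ i → d ∣ f i) → d ∣ sum f
∣-sum {zero}  {d = d} d∣f = d ∣0
∣-sum {suc n}         d∣f = ∣m∣n⇒∣m+n (d∣f zero) (∣-sum (d∣f ∘ suc))

2∣sum-paired : {A : Set} {R : Rel A 0ℓ} (g : A → ℕ) → (∀ {x y} → R x y → g x ≡ g y) →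
               ∀ h {b} → Paired R h b → 2 ∣ ∑[ i < h * 2 ] g (b i)
2∣sum-paired g g-resp zero        _          = 2 ∣0
2∣sum-paired g g-resp (suc h) {b} (b₀~b₁ , b-paired) =
  subst (2 ∣_) (+-assoc (g (b zero)) _ _) (∣m∣n⇒∣m+n 2∣first (2∣sum-paired g g-resp h b-paired))
  where
  2∣first : 2 ∣ g (b zero) + g (b (suc zero))
  2∣first = divides (g (b zero)) (trans (cong (g (b zero) +_) (sym (g-resp b₀~b₁)))
    (solve 1 (λ x → x :+ x := x :* con 2) refl (g (b zero))))

-- Color counts as double sums over vertices

length-filter-tabulate : {A B : Set} {P : Pred B 0ℓ} (P? : U.Decidable P) (f : A → Maybe B) (g : Fin n → A) →
  length (filter P? (mapMaybe f (tabulate g))) ≡ ∑[ i < n ] maybe′ (λ b → [ P? b ]) 0 (f (g i))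
length-filter-tabulate {zero}  P? f g = refl
length-filter-tabulate {suc n} P? f g with f (g zero)
... | nothing = length-filter-tabulate P? f (g ∘ suc)
... | just b with P? b
...   | yes _ = cong suc (length-filter-tabulate P? f (g ∘ suc))
...   | no  _ = length-filter-tabulate P? f (g ∘ suc)

length-filter-product :
  {A B C : Set} {P : Pred C 0ℓ} (P? : U.Decidable P) (f : A × B → Maybe C) (g : Fin m → A) (k : Fin n → B) →
  length (filter P? (mapMaybe f (cartesianProduct (tabulate g) (tabulate k)))) ≡
  ∑₂ (λ i j → maybe′ (λ e → [ P? e ]) 0 (f (g i , k j)))
length-filter-product {zero}  P? f g k = refl
length-filter-product {suc m} P? f g k = begin
  length (filter P? (mapMaybe f (row List.++ rest)))
    ≡⟨ cong (length ∘ filter P?) (List.mapMaybe-++ f row rest) ⟩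
  length (filter P? (mapMaybe f row List.++ mapMaybe f rest))
    ≡⟨ cong length (List.filter-++ P? (mapMaybe f row) (mapMaybe f rest)) ⟩
  length (filter P? (mapMaybe f row) List.++ filter P? (mapMaybe f rest))
    ≡⟨ List.length-++ (filter P? (mapMaybe f row)) ⟩
  length (filter P? (mapMaybe f row)) + length (filter P? (mapMaybe f rest))
    ≡⟨ cong₂ _+_
         (trans (cong (length ∘ filter P? ∘ mapMaybe f) (List.map-tabulate k (g zero ,_)))
                (length-filter-tabulate P? f (λ j → g zero , k j)))
         (length-filter-product P? f (g ∘ suc) k) ⟩
  ∑₂ (λ i j → maybe′ (λ e → [ P? e ]) 0 (f (g i , k j))) ∎
  where
  open ≡-Reasoning
  row  = List.map (g zero ,_) (tabulate k)
  rest = cartesianProduct (tabulate (g ∘ suc)) (tabulate k)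

module _ {G H : Graph} {r : ℕ} (χ : EdgeColoring G r) (φ : Copy H G) (c : Fin r) where
  open EdgeColoring χ
  open Copy φ

  -- The test `u < v` from `edges` is kept, so an edge has weight in one orientation only; the
  -- default 0 covers all other pairs.
  edgeWeight : Vertex H → Vertex H → ℕ
  edgeWeight u v = maybe′ (λ e → [ edgeColor χ φ e Fin.≟ c ]) 0
    (Maybe.map ((u , v) ,_) (dec⇒maybe (u Fin.<? v ×-dec adj? H u v)))

  occurrences≡∑edgeWeight : occurrences χ φ c ≡ ∑₂ edgeWeight
  occurrences≡∑edgeWeight = length-filter-product {m = order H} {n = order H} (λ e → edgeColor χ φ e Fin.≟ c)
    (λ (u , v) → Maybe.map ((u , v) ,_) (dec⇒maybe (u Fin.<? v ×-dec adj? H u v))) id id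

  edgeWeight-nonEdge : ∀ u v → ¬ (u Fin.< v × Adj H u v) → edgeWeight u v ≡ 0
  edgeWeight-nonEdge u v ¬uv with u Fin.<? v ×-dec adj? H u v
  ... | yes uv = contradiction uv ¬uv
  ... | no _   = refl

  -- The color is assumed for every adjacency proof because the decision procedure produces its own.
  edgeWeight-edge : ∀ u v e → u Fin.< v × Adj H u v → (∀ uv → color (adj {u} {v} uv) ≡ e) → edgeWeight u v ≡ [ e Fin.≟ c ]
  edgeWeight-edge u v e uv color≡e with u Fin.<? v ×-dec adj? H u v
  ... | yes (_ , a) = cong (λ z → [ z Fin.≟ c ]) (color≡e a)
  ... | no ¬uv      = contradiction uv ¬uv

-- Passing through the reversed edge and back removes the dependence of the color on the proof of
-- `u ≢ v`.
color-cong : (χ : EdgeColoring (K n) r) → ∀ {u u′ v v′} (uv : u ≢ v) (u′v′ : u′ ≢ v′) → u ≡ u′ → v ≡ v′ →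
             EdgeColoring.color χ uv ≡ EdgeColoring.color χ u′v′
color-cong χ uv u′v′ refl refl = trans (symmetric uv (≢-sym uv)) (sym (symmetric u′v′ (≢-sym uv)))
  where open EdgeColoring χ

-- The copy of K[ s , t ] across two halves of K n

module _ {m n r : ℕ} (χ : EdgeColoring (K n) r) (m+m≤n : m + m ≤ n) where
  open EdgeColoring χ

  -- The halves V and X: the first m vertices and the m vertices after them.
  left right : Fin m → Fin n
  left  a = inject≤ (a ↑ˡ m) m+m≤n
  right x = inject≤ (m ↑ʳ x) m+m≤n

  left-injective : Injective _≡_ _≡_ left
  left-injective eq = Fin.↑ˡ-injective m _ _ (Fin.inject≤-injective _ _ _ _ eq)

  right-injective : Injective _≡_ _≡_ right
  right-injective eq = Fin.↑ʳ-injective m _ _ (Fin.inject≤-injective _ _ _ _ eq)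

  left≢right : ∀ a x → left a ≢ right x
  left≢right a x eq = <⇒≢ (<-≤-trans (Fin.toℕ<n a) (m≤m+n m (toℕ x))) (begin
    toℕ a           ≡⟨ Fin.toℕ-↑ˡ a m ⟨
    toℕ (a ↑ˡ m)    ≡⟨ cong toℕ (Fin.inject≤-injective m+m≤n m+m≤n (a ↑ˡ m) (m ↑ʳ x) eq) ⟩
    toℕ (m ↑ʳ x)    ≡⟨ Fin.toℕ-↑ʳ m x ⟩
    m + toℕ x       ∎)
    where open ≡-Reasoning

  bipartiteColor : Fin m → Fin m → Fin r
  bipartiteColor a x = color (left≢right a x)

  module _ {s : ℕ} (h : ℕ) (A : Vector (Fin m) s) (b : Vector (Fin m) (h * 2))
           (A-inj : Injective _≡_ _≡_ A) (b-inj : Injective _≡_ _≡_ b) where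

    private
      t = h * 2

      place : Fin s ⊎ Fin t → Fin n
      place = [ left ∘ A , right ∘ b ]′

      place-injective : Injective _≡_ _≡_ place
      place-injective {inj₁ i} {inj₁ j} eq = cong inj₁ (A-inj (left-injective eq))
      place-injective {inj₁ i} {inj₂ j} eq = contradiction eq (left≢right (A i) (b j))
      place-injective {inj₂ i} {inj₁ j} eq = contradiction (sym eq) (left≢right (A j) (b i))
      place-injective {inj₂ i} {inj₂ j} eq = cong inj₂ (b-inj (right-injective eq))

      splitAt-injective : Injective _≡_ _≡_ (splitAt s {t})
      splitAt-injective {u} {v} eq =
        trans (sym (Fin.join-splitAt s t u)) (trans (cong (Fin.join s t) eq) (Fin.join-splitAt s t v))

      vertex-injective : Injective _≡_ _≡_ (place ∘ splitAt s {t})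
      vertex-injective eq = splitAt-injective (place-injective eq)

    copy : Copy K[ s , t ] (K n)
    copy = record
      { vertex    = place ∘ splitAt s
      ; injective = vertex-injective
      ; adj       = λ uv eq → Graph.irrefl K[ s , t ] (vertex-injective eq) uv
      }

    private
      -- Edges are listed with the smaller end first and the left part has the smaller indices, so a
      -- left vertex is never the second end.
      nonEdge-left : ∀ u i → ¬ (u Fin.< i ↑ˡ t × Adj K[ s , t ] u (i ↑ˡ t))
      nonEdge-left u i (_ , inj₁ (_ , s≤i)) =
        <⇒≱ (Fin.toℕ<n i) (≤-trans s≤i (≤-reflexive (Fin.toℕ-↑ˡ i t)))
      nonEdge-left u i (u<i , inj₂ (i<s , s≤u)) = <⇒≱ (<-trans u<i i<s) s≤u

      nonEdge-right : ∀ j v → ¬ (s ↑ʳ j Fin.< v × Adj K[ s , t ] (s ↑ʳ j) v)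
      nonEdge-right j v (_ , inj₁ (j<s , _)) =
        <⇒≱ j<s (≤-trans (m≤m+n s (toℕ j)) (≤-reflexive (sym (Fin.toℕ-↑ʳ s j))))
      nonEdge-right j v (j<v , inj₂ (v<s , s≤j)) = <⇒≱ (<-trans j<v v<s) s≤j

      edge : ∀ i j → i ↑ˡ t Fin.< s ↑ʳ j × Adj K[ s , t ] (i ↑ˡ t) (s ↑ʳ j)
      edge i j = <-≤-trans i<s s≤j , inj₁ (i<s , s≤j)
        where
        i<s : toℕ (i ↑ˡ t) < s
        i<s = subst (_< s) (sym (Fin.toℕ-↑ˡ i t)) (Fin.toℕ<n i)
        s≤j : s ≤ toℕ (s ↑ʳ j)
        s≤j = subst (s ≤_) (sym (Fin.toℕ-↑ʳ s j)) (m≤m+n s (toℕ j))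

    -- The row of a left vertex sums an indicator over `b` that is equal within each pair; the row
    -- of a right vertex vanishes.
    2∣occurrences : Paired (Agree bipartiteColor A) h b → ∀ c → 2 ∣ occurrences χ copy c
    2∣occurrences b-paired c = subst (2 ∣_) (sym (occurrences≡∑edgeWeight χ copy c)) (∣-sum 2∣row)
      where
      W = edgeWeight χ copy c
      0≡⇒2∣ : ∀ {x} → x ≡ 0 → 2 ∣ x
      0≡⇒2∣ x≡0 = subst (2 ∣_) (sym x≡0) (2 ∣0)
      W-edge : ∀ i j → W (i ↑ˡ t) (s ↑ʳ j) ≡ [ bipartiteColor (A i) (b j) Fin.≟ c ]
      W-edge i j = edgeWeight-edge χ copy c (i ↑ˡ t) (s ↑ʳ j) _ (edge i j) (λ uv → color-cong χ _ _
        (cong place (Fin.splitAt-↑ˡ s i t)) (cong place (Fin.splitAt-↑ʳ s t j)))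
      -- Writing the row index as a `join` exposes its part; `2∣row` transports the result back
      -- along `join-splitAt`.
      2∣row′ : ∀ v → 2 ∣ ∑[ j < t ] W (Fin.join s t v) (s ↑ʳ j)
      2∣row′ (inj₁ i) = subst (2 ∣_) (sym (sum-cong-≗ (W-edge i)))
        (2∣sum-paired (λ x → [ bipartiteColor (A i) x Fin.≟ c ])
          (λ x~y → cong (λ z → [ z Fin.≟ c ]) (x~y i)) h b-paired)
      2∣row′ (inj₂ j) = ∣-sum (λ v → 0≡⇒2∣ (edgeWeight-nonEdge χ copy c _ _ (nonEdge-right j (s ↑ʳ v))))
      2∣row : ∀ u → 2 ∣ sum (W u)
      2∣row u = subst (2 ∣_) (sym (sum-++ s (W u))) (∣m∣n⇒∣m+n
        (∣-sum (λ i → 0≡⇒2∣ (edgeWeight-nonEdge χ copy c u _ (nonEdge-left u i))))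
        (subst (λ u → 2 ∣ ∑[ j < t ] W u (s ↑ʳ j)) (Fin.join-splitAt s t u) (2∣row′ (splitAt s u))))

-- Odd-Ramsey colorings need many colors

-- The factor 9 pays for n ≤ 3 (n / 2); the two summands are the bounds on
-- m² / r ^ s and on m / r required by ∃-even-bipartite.
threshold : ℕ → ℕ → ℕ
threshold s h = 9 * (suc (16 ^ s * maxPairs h) + (8 * suc s) * (8 * suc s))

n≤3*half : ∀ n → 2 ≤ n → n ≤ 3 * (n / 2)
n≤3*half n 2≤n = begin
  n                    ≡⟨ m≡m%n+[m/n]*n n 2 ⟩
  n % 2 + n / 2 * 2    ≤⟨ +-monoˡ-≤ (n / 2 * 2) (≤-trans (s≤s⁻¹ (m%n<n n 2)) (/-monoˡ-≤ 2 2≤n)) ⟩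
  n / 2 + n / 2 * 2    ≡⟨ solve 1 (λ m → m :+ m :* con 2 := con 3 :* m) refl (n / 2) ⟩
  3 * (n / 2)          ∎
  where open ≤-Reasoning

square-cancel-≤ : ∀ {a b} → a * a ≤ b * b → a ≤ b
square-cancel-≤ a²≤b² = ≮⇒≥ (λ b<a → <⇒≱ (*-mono-< b<a b<a) a²≤b²)

-- The hypothesis passes to halves of size n / 2 and there yields a copy in which every color count
-- is even, against the odd color promised by the coloring.
not-colorable : ∀ i h → 1 ≤ r → threshold (2 + i) h * r ^ (2 + i) ≤ n * n →
                ¬ OddRamseyColorable n K[ 2 + i , h * 2 ] r
not-colorable {r} {n} i h 1≤r n²-large (χ , odd) = 1≢0 (trans (sym c-odd) (n∣m⇒m%n≡0 _ 2 c-even))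
  where
  open ≤-Reasoning
  s = 2 + i
  T = 16 ^ s * maxPairs h
  k = 8 * suc s
  half = n / 2
  1≢0 : 1 ≢ 0
  1≢0 ()
  1≤r^ : ∀ j → 1 ≤ r ^ j
  1≤r^ j = m^n>0 r {{>-nonZero 1≤r}} j
  2≤n : 2 ≤ n
  2≤n = square-cancel-≤ (begin
    4                          ≤⟨ *-mono-≤ {4} {9} (m≤m+n 4 5) (s≤s z≤n) ⟩
    threshold s h              ≡⟨ *-identityʳ _ ⟨
    threshold s h * 1          ≤⟨ *-monoʳ-≤ (threshold s h) (1≤r^ s) ⟩
    threshold s h * r ^ s      ≤⟨ n²-large ⟩
    n * n                      ∎)
  half²-large : (suc T + k * k) * r ^ s ≤ half * half
  half²-large = *-cancelˡ-≤ 9 (begin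
    9 * ((suc T + k * k) * r ^ s)  ≡⟨ *-assoc 9 (suc T + k * k) (r ^ s) ⟨
    threshold s h * r ^ s          ≤⟨ n²-large ⟩
    n * n                          ≤⟨ *-mono-≤ (n≤3*half n 2≤n) (n≤3*half n 2≤n) ⟩
    3 * half * (3 * half)          ≡⟨ solve 1 (λ m → con 3 :* m :* (con 3 :* m) := con 9 :* (m :* m)) refl half ⟩
    9 * (half * half)              ∎)
  T-bound : (16 * r) ^ s * maxPairs h < half * half
  T-bound = begin-strict
    (16 * r) ^ s * maxPairs h      ≡⟨ cong (_* maxPairs h) (^-distribʳ-* s 16 r) ⟩
    16 ^ s * r ^ s * maxPairs h    ≡⟨ xyz≡xzy (16 ^ s) (r ^ s) (maxPairs h) ⟩
    T * r ^ s                      <⟨ *-monoˡ-< (r ^ s) {{>-nonZero (1≤r^ s)}} (n<1+n T) ⟩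
    suc T * r ^ s                  ≤⟨ *-monoˡ-≤ (r ^ s) (m≤m+n (suc T) (k * k)) ⟩
    (suc T + k * k) * r ^ s        ≤⟨ half²-large ⟩
    half * half                    ∎
    where
    xyz≡xzy : ∀ x y z → x * y * z ≡ x * z * y
    xyz≡xzy = solve 3 (λ x y z → x :* y :* z := x :* z :* y) refl
  half-large : 8 * r * suc s ≤ half
  half-large = square-cancel-≤ (begin
    8 * r * suc s * (8 * r * suc s)
      ≡⟨ solve 2 (λ r s → con 8 :* r :* s :* (con 8 :* r :* s) := con 8 :* s :* (con 8 :* s) :* (r :* (r :* con 1))) refl r (suc s) ⟩
    -- Here r² ≤ r ^ s, as s = 2 + i and r is positive.
    k * k * r ^ 2                  ≤⟨ *-mono-≤ (m≤n+m (k * k) (suc T)) (^-monoʳ-≤ r {{>-nonZero 1≤r}} (m≤m+n 2 i)) ⟩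
    (suc T + k * k) * r ^ s        ≤⟨ half²-large ⟩
    half * half                    ∎)
  1≤half : 1 ≤ half
  1≤half = *-cancelˡ-< 3 0 half (≤-trans (≤-trans (s≤s z≤n) 2≤n) (n≤3*half n 2≤n))
  half+half≤n : half + half ≤ n
  half+half≤n = ≤-trans (≤-reflexive (solve 1 (λ m → m :+ m := m :* con 2) refl half)) (m/n*n≤m n 2)
  -- `≤-refl` fixes `R` as `16 * r`; the argument `suc i` stands for s - 1.
  configuration = ∃-even-bipartite (bipartiteColor χ half+half≤n) (suc i) h ≤-refl 1≤half 1≤r half-large T-bound
  A        = proj₁ configuration
  b        = proj₁ (proj₂ configuration)
  A-inj : Injective _≡_ _≡_ A
  A-inj = proj₁ (proj₂ (proj₂ configuration))
  b-inj : Injective _≡_ _≡_ b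
  b-inj = proj₁ (proj₂ (proj₂ (proj₂ configuration)))
  b-paired = proj₂ (proj₂ (proj₂ (proj₂ configuration)))
  φ        = copy χ half+half≤n h A b A-inj b-inj
  c        = proj₁ (odd φ)
  c-odd    = proj₂ (odd φ)
  c-even   = 2∣occurrences χ half+half≤n h A b A-inj b-inj b-paired c

-- Comparison of exponents

n≤n² : ∀ n → n ≤ n * n
n≤n² zero    = z≤n
n≤n² (suc n) = m≤m+n (suc n) _

-- For j = 2k, `exponent s k` is the unreduced fraction 2j / (s j + 2). The j-th power of n² < C r ^
-- s bounds r ^ (s j + 2) by C ^ j r ^ (s j), leaving r² ≤ C ^ j.
n²<Crˢ⇒r≤Cʲ : ∀ s j C → 1 ≤ r → n * n < C * r ^ s → r ^ (s * j + 1 * 2) ≤ n ^ (2 * j) → r ≤ C ^ j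
n²<Crˢ⇒r≤Cʲ {r} {n} s j C 1≤r n²< pow≤ = ≤-trans (n≤n² r)
  (*-cancelʳ-≤ (r * r) (C ^ j) (r ^ (s * j)) {{m^n≢0 r (s * j) {{>-nonZero 1≤r}}}} (begin
  r * r * r ^ (s * j)        ≡⟨ solve 2 (λ r x → r :* r :* x := x :* (r :* (r :* con 1))) refl r (r ^ (s * j)) ⟩
  r ^ (s * j) * r ^ 2        ≡⟨ ^-distribˡ-+-* r (s * j) 2 ⟨
  r ^ (s * j + 2)            ≤⟨ pow≤ ⟩
  n ^ (2 * j)                ≡⟨ ^-*-assoc n 2 j ⟨
  (n ^ 2) ^ j                ≡⟨ cong (λ z → (n * z) ^ j) (*-identityʳ n) ⟩
  (n * n) ^ j                ≤⟨ ^-monoˡ-≤ j (<⇒≤ n²<) ⟩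
  (C * r ^ s) ^ j            ≡⟨ ^-distribʳ-* j C (r ^ s) ⟩
  C ^ j * (r ^ s) ^ j        ≡⟨ cong (C ^ j *_) (^-*-assoc r s j) ⟩
  C ^ j * r ^ (s * j)        ∎))
  where open ≤-Reasoning

-- Otherwise r is bounded by a constant depending on C and k alone, and then C r ^ (s + 1) cannot
-- exceed a large n.
polynomial-gap : ∀ s k C → 1 ≤ r → C * (C ^ (2 * k)) ^ suc s ≤ n →
  ¬ (r > n ^ℚ exponent (suc s) k) → C * r ^ suc s ≤ n * n
polynomial-gap {r} {n} s k C 1≤r N≤n r≯ = ≮⇒≥ (λ n²< → <⇒≱ n²< (begin
  C * r ^ suc s                  ≤⟨ *-monoʳ-≤ C (^-monoˡ-≤ (suc s) (r≤ k n²< (≮⇒≥ r≯))) ⟩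
  C * (C ^ (2 * k)) ^ suc s      ≤⟨ N≤n ⟩
  n                              ≤⟨ n≤n² n ⟩
  n * n                          ∎))
  where
  open ≤-Reasoning
  r≤ : ∀ k → n * n < C * r ^ suc s →
       r ^ ↧ₙ (exponent (suc s) k) ≤ n ^ ∣ ↥ (exponent (suc s) k) ∣ → r ≤ C ^ (2 * k)
  -- The exponent is 0 / 1, so the hypothesis reads r ^ 1 ≤ n ^ 0 = 1.
  r≤ zero    _   pow≤ = ≤-trans (≤-reflexive (sym (*-identityʳ r))) pow≤
  r≤ (suc k) n²< pow≤ = n²<Crˢ⇒r≤Cʲ {n = n} (suc s) (2 * suc k) C 1≤r n²< pow≤

theorem1p3 : (s t : ℕ) → 3 ≤ s → s ≤ t → Odd s → Even t →
    ∃[ N ] (∀ n → N ≤ n → ∀ r → IsOddRamseyNumber n K[ s , t ] r →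
    r > n ^ℚ exponent s (t / 8))
theorem1p3 (suc (suc i)) t (s≤s (s≤s _)) s≤t odd-s even-t with m%n≡0⇒n∣m t 2 even-t
-- The witness is the lower bound on n asked for by `polynomial-gap`. The goal is a decidable
-- inequality, so it may be proved by contradiction.
... | divides h refl = C * (C ^ (2 * (t / 8))) ^ (2 + i) , λ n N≤n r r-odd →
  decidable-stable (_ <? _) (λ r≯ → not-colorable i h (positive r-odd)
    (polynomial-gap (suc i) (t / 8) C (positive r-odd) N≤n r≯) (colorable r-odd))
  where
  open IsOddRamseyNumber
  C = threshold (2 + i) h
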